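{- Every bi-arborescence on $n\ge 2$ vertices is $(2n-2)$-unavoidable.
   Context: A tournament is an orientation of a complete graph. An oriented graph $D$ is $m$-unavoidable if every tournament on $m$ vertices contains a copy of $D$ (as a not necessarily induced subdigraph). An out-arborescence (in-arborescence) is a rooted oriented tree all of whose arcs point away from (towards) its root. A bi-arborescence is a rooted oriented tree that is the union of an in-arborescence and an out-arborescence meeting only in their common root (either of the two may consist of the root alone). -}

module Defs where

open import Data.Nat using (ℕ; _≤_)
open import Data.Fin using (Fin)
open import Data.Fin.Subset using (Subset; _∈_; _∪_; _∩_; ⁅_⁆; ⊤)
open import Data.Fin.Subset.Properties using (∈⊤)
open import Data.List using (List; []; _∷_; length)
open import Data.List.Membership.Propositional using () renaming (_∉_ to _∉ₗ_)
open import Data.List.Relation.Unary.Unique.Propositional using (Unique)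
open import Data.Product using (∃-syntax; _×_)
open import Data.Sum using (_⊎_)
open import Function using (id)
open import Function.Definitions using (Injective)
open import Level using (0ℓ)
open import Relation.Binary using (Rel; Decidable; Asymmetric)
open import Relation.Binary.Construct.Closure.Symmetric using (SymClosure)
open import Relation.Binary.PropositionalEquality using (_≡_; _≢_)
open import Relation.Nullary using (¬_)

record OrientedGraph (n : ℕ) : Set₁ where
  field
    _⟶_  : Rel (Fin n) 0ℓ
    _⟶?_ : Decidable _⟶_
    asym : Asymmetric _⟶_

IsTournament : ∀ {m} → OrientedGraph m → Set
IsTournament T = ∀ u v → u ≢ v → u ⟶ v ⊎ v ⟶ u
  where open OrientedGraph T

_Contains_ : ∀ {m n} → OrientedGraph m → OrientedGraph n → Set
_Contains_ {m} {n} G D =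
  ∃[ f ] Injective _≡_ _≡_ f × (∀ {u v : Fin n} → u D.⟶ v → f u G.⟶ f v)
  where
  module G = OrientedGraph G
  module D = OrientedGraph D

Unavoidable : ∀ {n} → ℕ → OrientedGraph n → Set₁
Unavoidable m D = (T : OrientedGraph m) → IsTournament T → T Contains D

record Subgraph {n : ℕ} (G : OrientedGraph n) : Set₁ where
  open OrientedGraph G using (_⟶_)
  field
    vertices : Subset n
    arc      : Rel (Fin n) 0ℓ
    arc⇒⟶    : ∀ {u v} → arc u v → u ⟶ v
    tail∈    : ∀ {u v} → arc u v → u ∈ vertices
    head∈    : ∀ {u v} → arc u v → v ∈ vertices

whole : ∀ {n} (G : OrientedGraph n) → Subgraph G
whole G = record
  { vertices = ⊤
  ; arc      = OrientedGraph._⟶_ G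
  ; arc⇒⟶    = id
  ; tail∈    = λ _ → ∈⊤
  ; head∈    = λ _ → ∈⊤
  }

-- Walk R x y p: the list p of vertices, including both x and y, is an
-- R-walk from x to y.
data Walk {V : Set} (R : Rel V 0ℓ) : V → V → List V → Set where
  [-] : ∀ {x} → Walk R x x (x ∷ [])
  _∷_ : ∀ {x y z p} → R x y → Walk R y z p → Walk R x z (x ∷ p)

module _ {n : ℕ} {G : OrientedGraph n} (H : Subgraph G) where
  open Subgraph H

  Adjacent : Rel (Fin n) 0ℓ
  Adjacent = SymClosure arc

  -- Paths and cycles are those of the underlying undirected graph.
  IsPath : Fin n → Fin n → List (Fin n) → Set
  IsPath x y p = Walk Adjacent x y p × Unique p

  Connected : Set
  Connected = ∀ {x y} → x ∈ vertices → y ∈ vertices → ∃[ p ] IsPath x y p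

  -- A cycle is a path on at least three vertices whose ends are adjacent.
  Acyclic : Set
  Acyclic = ∀ {x y p} → IsPath x y p → 3 ≤ length p → ¬ Adjacent y x

  record IsRootedTree (r : Fin n) : Set where
    field
      root∈     : r ∈ vertices
      connected : Connected
      acyclic   : Acyclic

  -- The path from r to u avoids v.  For adjacent u and v in a tree this
  -- says that u is the end of the edge uv nearer to r.
  Nearer : (r u v : Fin n) → Set
  Nearer r u v = ∃[ p ] IsPath r u p × v ∉ₗ p

  record IsOutArborescence (r : Fin n) : Set where
    field
      isRootedTree : IsRootedTree r
      away         : ∀ {u v} → arc u v → Nearer r u v

  record IsInArborescence (r : Fin n) : Set where
    field
      isRootedTree : IsRootedTree r
      towards      : ∀ {u v} → arc u v → Nearer r v u

record IsBiArborescenceAt {n : ℕ} (D : OrientedGraph n) (r : Fin n) : Set₁ where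
  open OrientedGraph D using (_⟶_)
  field
    isRootedTree : IsRootedTree (whole D) r
    inPart       : Subgraph D
    outPart      : Subgraph D
  module I = Subgraph inPart
  module O = Subgraph outPart
  field
    isInArborescence  : IsInArborescence inPart r
    isOutArborescence : IsOutArborescence outPart r
    vertices-union    : I.vertices ∪ O.vertices ≡ ⊤
    arcs-union        : ∀ {u v} → u ⟶ v → I.arc u v ⊎ O.arc u v
    meet              : I.vertices ∩ O.vertices ≡ ⁅ r ⁆

IsBiArborescence : ∀ {n} → OrientedGraph n → Set₁
IsBiArborescence D = ∃[ r ] IsBiArborescenceAt D r

{-# OPTIONS --safe #-}
module Submission where

-- Order the tournament so that no single vertex can be moved to decrease the number of backward
-- arcs: then every vertex dominates at least half of any block immediately behind it and is
-- dominated by at least half of any block immediately before it (a local median order).  An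
-- out-arborescence with k arcs is embedded leaf by leaf, its root at the front, such that at most
-- (2k − i)/2 of its non-root vertices lie beyond position i.  The parent of a new leaf, at position
-- i, dominates at least half of positions i+1, …, 2k+1, hence an unused one among them.  So 2k
-- positions suffice (one if k = 0).  In a bi-arborescence with a in-arcs and b out-arcs,
-- 2a + 2b = 2n − 2; placing the root at position 2a − 1 (0 if a = 0) leaves room for the out-part
-- behind it and, in the reversed order, for the in-part before it.

open import Data.Fin using (Fin; zero; suc; toℕ)
import Data.Fin.Properties as Fin
open import Data.Fin.Subset using () renaming (_∈_ to _∈ₛ_; _∉_ to _∉ₛ_)
open import Data.Fin.Subset.Properties as Subset using () renaming (_∈?_ to _∈ₛ?_)
open import Data.List
  using (List; []; _∷_; [_]; allFin; _++_; length; lookup; filter; map; take; drop; reverse)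
open import Data.List.Membership.Propositional using (_∈_; _∉_; find; lose)
open import Data.List.Membership.Propositional.Properties
  using (∈-lookup; ∈-filter⁺; ∈-filter⁻; ∈-map⁺; ∈-allFin; ∈-++⁺ʳ)
open import Data.List.Properties
open import Data.List.Relation.Binary.Permutation.Propositional
  using (_↭_; ↭-refl; ↭-sym; ↭-trans; prep; ↭⇒↭ₛ)
open import Data.List.Relation.Binary.Permutation.Propositional.Properties
  using (↭-length; ↭-reverse; filter-↭; shift; ∈-resp-↭)
import Data.List.Relation.Binary.Permutation.Setoid.Properties as Permutationₛ
open import Data.List.Relation.Unary.All as All using (All; []; _∷_)
import Data.List.Relation.Unary.All.Properties as All
open import Data.List.Relation.Unary.AllPairs using ([]; _∷_)
open import Data.List.Relation.Unary.Any using (here; there; any?; index)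
import Data.List.Relation.Unary.Any.Properties as Any
open import Data.List.Relation.Unary.Unique.Propositional using (Unique)
import Data.List.Relation.Unary.Unique.Propositional.Properties as Unique
open import Data.Nat
open import Data.Nat.Induction using (<-wellFounded)
open import Data.Nat.Properties
open import Data.Nat.Tactic.RingSolver using (solve-∀)
open import Data.Product using (∃; ∃-syntax; _×_; _,_; proj₁; proj₂)
open import Data.Sum using (_⊎_; inj₁; inj₂; swap)
open import Function using (_∘_; flip)
open import Induction.WellFounded using (Acc; acc)
open import Level using (0ℓ)
open import Relation.Binary using (Rel; Decidable; DecidableEquality)
open import Relation.Binary.Construct.Closure.Symmetric using (fwd; bwd; symmetric)
open import Relation.Binary.PropositionalEquality hiding ([_]; J)
open import Relation.Nullary using (¬_; Dec; yes; no; contradiction)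
open import Relation.Nullary.Decidable using (¬?; _×-dec_)
import Relation.Unary as U

open import Defs

-- Lists without repetition: membership and counting.

∈-insert₂⁻ : ∀ {A : Set} {v r x : A} {vs} → v ∈ r ∷ x ∷ vs → v ≡ x ⊎ v ∈ r ∷ vs
∈-insert₂⁻ (here v≡r)         = inj₂ (here v≡r)
∈-insert₂⁻ (there (here v≡x)) = inj₁ v≡x
∈-insert₂⁻ (there (there v∈)) = inj₂ (there v∈)

∈-insert₂⁺ : ∀ {A : Set} {v r x : A} {vs} → v ∈ r ∷ vs → v ∈ r ∷ x ∷ vs
∈-insert₂⁺ (here v≡r) = here v≡r
∈-insert₂⁺ (there v∈) = there (there v∈)

lookup-injective : ∀ {A : Set} {xs : List A} → Unique xs →
                   ∀ {i j} → lookup xs i ≡ lookup xs j → i ≡ j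
lookup-injective (_ ∷ _)  {zero}  {zero}  _  = refl
lookup-injective (x∉ ∷ _) {zero}  {suc j} eq = contradiction eq (All.lookup x∉ (∈-lookup j))
lookup-injective (x∉ ∷ _) {suc i} {zero}  eq = contradiction (sym eq) (All.lookup x∉ (∈-lookup i))
lookup-injective (_ ∷ xs!) {suc i} {suc j} eq = cong suc (lookup-injective xs! eq)

-- Sending each index of `xs` to the index of an occurrence of its entry in `ys` is injective.
unique⊆⇒length≤ : ∀ {A : Set} {xs ys : List A} → Unique xs →
                  (∀ {x} → x ∈ xs → x ∈ ys) → length xs ≤ length ys
unique⊆⇒length≤ {xs = xs} {ys} xs! xs⊆ys = Fin.injective⇒≤ {f = place} place-injective
  where
  place : Fin (length xs) → Fin (length ys)
  place i = index (xs⊆ys (∈-lookup i))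

  place-injective : ∀ {i j} → place i ≡ place j → i ≡ j
  place-injective {i} {j} eq = lookup-injective xs!
    (trans (Any.lookup-index (xs⊆ys (∈-lookup i)))
      (trans (cong (lookup ys) eq) (sym (Any.lookup-index (xs⊆ys (∈-lookup j))))))

pigeonhole : ∀ {A : Set} → DecidableEquality A → ∀ {xs ys : List A} → Unique xs →
             length ys < length xs → ∃[ x ] x ∈ xs × x ∉ ys
pigeonhole _≟ᴬ_ {xs} {ys} xs! ys<xs with any? (λ x → ¬? (any? (x ≟ᴬ_) ys)) xs
... | yes p = find p
... | no ¬p = contradiction (unique⊆⇒length≤ xs! xs⊆ys) (<⇒≱ ys<xs)
  where
  xs⊆ys : ∀ {x} → x ∈ xs → x ∈ ys
  xs⊆ys {x} x∈xs with any? (x ≟ᴬ_) ys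
  ... | yes x∈ys = x∈ys
  ... | no  x∉ys = contradiction (lose x∈xs x∉ys) ¬p

length-filter-mono : ∀ {A : Set} {P Q : U.Pred A 0ℓ} (P? : U.Decidable P) (Q? : U.Decidable Q) →
                     ∀ xs → (∀ {x} → x ∈ xs → P x → Q x) →
                     length (filter P? xs) ≤ length (filter Q? xs)
length-filter-mono P? Q? [] P⇒Q = z≤n
length-filter-mono P? Q? (x ∷ xs) P⇒Q with P? x | Q? x | length-filter-mono P? Q? xs (P⇒Q ∘ there)
... | yes Px | yes _  | ih = s≤s ih
... | yes Px | no ¬Qx | _  = contradiction (P⇒Q (here refl) Px) ¬Qx
... | no _   | yes _  | ih = m≤n⇒m≤1+n ih
... | no _   | no _   | ih = ih

∈-take-drop⁻ : ∀ {A : Set} a ℓ (xs : List A) {z} → z ∈ take ℓ (drop a xs) →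
               ∃[ j ] lookup xs j ≡ z × a ≤ toℕ j × toℕ j < a + ℓ
∈-take-drop⁻ zero    (suc ℓ) (x ∷ xs) (here refl) = zero , refl , z≤n , s≤s z≤n
∈-take-drop⁻ zero    (suc ℓ) (x ∷ xs) (there z∈) with ∈-take-drop⁻ zero ℓ xs z∈
... | j , eq , _ , j<ℓ = suc j , eq , z≤n , s≤s j<ℓ
∈-take-drop⁻ (suc a) zero    []       ()
∈-take-drop⁻ (suc a) (suc ℓ) []       ()
∈-take-drop⁻ (suc a) ℓ       (x ∷ xs) z∈ with ∈-take-drop⁻ a ℓ xs z∈
... | j , eq , a≤j , j<a+ℓ = suc j , eq , s≤s a≤j , s≤s j<a+ℓ

-- Backward arcs and local median orders.

deg : ∀ {A : Set} {R : Rel A 0ℓ} → Decidable R → A → List A → ℕ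
deg R? x ys = length (filter (R? x) ys)

-- Each backward arc is counted at its earlier end, hence the `flip`.
backArcs : ∀ {A : Set} {R : Rel A 0ℓ} → Decidable R → List A → ℕ
backArcs R? []       = 0
backArcs R? (x ∷ xs) = deg (flip R?) x xs + backArcs R? xs

-- The condition on blocks immediately behind a vertex, doubled to avoid halves. Blocks before a
-- vertex are covered by the same condition for `flip R?` on the reversed list.
data Feedback {A : Set} {R : Rel A 0ℓ} (R? : Decidable R) : List A → Set where
  []  : Feedback R? []
  _∷_ : ∀ {x xs} → (∀ {ℓ} → ℓ ≤ length xs → ℓ ≤ 2 * deg R? x (take ℓ xs)) →
        Feedback R? xs → Feedback R? (x ∷ xs)

module _ {A : Set} {R : Rel A 0ℓ} (R? : Decidable R) where

  deg-++ : ∀ x ys zs → deg R? x (ys ++ zs) ≡ deg R? x ys + deg R? x zs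
  deg-++ x ys zs = trans (cong length (filter-++ (R? x) ys zs)) (length-++ (filter (R? x) ys))

  deg-↭ : ∀ x {ys zs} → ys ↭ zs → deg R? x ys ≡ deg R? x zs
  deg-↭ x ys↭zs = ↭-length (filter-↭ (R? x) ys↭zs)

  feedback-++⁻ʳ : ∀ xs {ys} → Feedback R? (xs ++ ys) → Feedback R? ys
  feedback-++⁻ʳ []       fb       = fb
  feedback-++⁻ʳ (x ∷ xs) (_ ∷ fb) = feedback-++⁻ʳ xs fb

  feedback-lookup : ∀ {xs} → Feedback R? xs → ∀ i {ℓ} → ℓ ≤ length (drop (suc (toℕ i)) xs) →
                    ℓ ≤ 2 * deg R? (lookup xs i) (take ℓ (drop (suc (toℕ i)) xs))
  feedback-lookup (p ∷ _)  zero    = p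
  feedback-lookup (_ ∷ fb) (suc i) = feedback-lookup fb i

module _ {A : Set} {R : Rel A 0ℓ} (R? : Decidable R) where

  deg-flip : ∀ x y → deg (flip R?) y [ x ] ≡ deg R? x [ y ]
  deg-flip x y with R? x y
  ... | yes _ = refl
  ... | no _  = refl

  -- `backArcs` peels off the first entry; reversing a list requires peeling off the last one.
  backArcs-∷ʳ : ∀ xs x → backArcs R? (xs ++ [ x ]) ≡ backArcs R? xs + deg R? x xs
  backArcs-∷ʳ []       x = refl
  backArcs-∷ʳ (y ∷ xs) x = begin
    deg (flip R?) y (xs ++ [ x ]) + backArcs R? (xs ++ [ x ])
      ≡⟨ cong₂ _+_ (trans (deg-++ (flip R?) y xs [ x ]) (cong (deg (flip R?) y xs +_) (deg-flip x y)))
                 (backArcs-∷ʳ xs x) ⟩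
    (deg (flip R?) y xs + deg R? x [ y ]) + (backArcs R? xs + deg R? x xs)
      ≡⟨ rearrange (deg (flip R?) y xs) (deg R? x [ y ]) (backArcs R? xs) (deg R? x xs) ⟩
    (deg (flip R?) y xs + backArcs R? xs) + (deg R? x [ y ] + deg R? x xs)
      ≡⟨ cong (deg (flip R?) y xs + backArcs R? xs +_) (deg-++ R? x [ y ] xs) ⟨
    (deg (flip R?) y xs + backArcs R? xs) + deg R? x (y ∷ xs) ∎
    where
    open ≡-Reasoning
    rearrange : ∀ a b c d → (a + b) + (c + d) ≡ (a + c) + (b + d)
    rearrange = solve-∀

  -- Moving x behind the block ys changes the orientation of exactly the arcs between x and ys;
  -- both sides are arranged so that no subtraction occurs.
  backArcs-move : ∀ x ys zs → backArcs R? (x ∷ ys ++ zs) + deg R? x ys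
                            ≡ backArcs R? (ys ++ x ∷ zs) + deg (flip R?) x ys
  backArcs-move x []       zs = refl
  backArcs-move x (y ∷ ys) zs = begin
    (deg F x (y ∷ ys ++ zs) + (deg F y (ys ++ zs) + b)) + deg R? x (y ∷ ys)
      ≡⟨ cong₂ (λ p q → (p + (deg F y (ys ++ zs) + b)) + q)
               (deg-++ F x [ y ] (ys ++ zs))
               (trans (deg-++ R? x [ y ] ys) (cong (_+ deg R? x ys) (sym (deg-flip x y)))) ⟩
    ((deg F x [ y ] + deg F x (ys ++ zs)) + (deg F y (ys ++ zs) + b)) + (deg F y [ x ] + deg R? x ys)
      ≡⟨ gather (deg F x [ y ]) (deg F x (ys ++ zs)) (deg F y (ys ++ zs)) b (deg F y [ x ]) (deg R? x ys) ⟩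
    (deg F y [ x ] + deg F y (ys ++ zs)) + (deg F x (ys ++ zs) + b + deg R? x ys) + deg F x [ y ]
      ≡⟨ cong₂ (λ p q → p + q + deg F x [ y ])
               (trans (sym (deg-++ F y [ x ] (ys ++ zs))) (deg-↭ F y (↭-sym (shift x ys zs))))
               (backArcs-move x ys zs) ⟩
    deg F y (ys ++ x ∷ zs) + (backArcs R? (ys ++ x ∷ zs) + deg F x ys) + deg F x [ y ]
      ≡⟨ spread (deg F y (ys ++ x ∷ zs)) (backArcs R? (ys ++ x ∷ zs)) (deg F x ys) (deg F x [ y ]) ⟩
    (deg F y (ys ++ x ∷ zs) + backArcs R? (ys ++ x ∷ zs)) + (deg F x [ y ] + deg F x ys)
      ≡⟨ cong (deg F y (ys ++ x ∷ zs) + backArcs R? (ys ++ x ∷ zs) +_) (deg-++ F x [ y ] ys) ⟨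
    (deg F y (ys ++ x ∷ zs) + backArcs R? (ys ++ x ∷ zs)) + deg F x (y ∷ ys) ∎
    where
    open ≡-Reasoning
    F = flip R?
    b = backArcs R? (ys ++ zs)
    gather : ∀ s p q b t r → ((s + p) + (q + b)) + (t + r) ≡ (t + q) + (p + b + r) + s
    gather = solve-∀
    spread : ∀ p q r s → p + (q + r) + s ≡ (p + q) + (s + r)
    spread = solve-∀

-- A backward arc stays backward when the order and all arcs are reversed. Hence an improvement of
-- the reversed order is one of the original order.
backArcs-reverse : ∀ {A : Set} {R : Rel A 0ℓ} (R? : Decidable R) xs →
                   backArcs (flip R?) (reverse xs) ≡ backArcs R? xs
backArcs-reverse R? []       = refl
backArcs-reverse R? (x ∷ xs) = begin
  backArcs (flip R?) (reverse (x ∷ xs))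
    ≡⟨ cong (backArcs (flip R?)) (unfold-reverse x xs) ⟩
  backArcs (flip R?) (reverse xs ++ [ x ])
    ≡⟨ backArcs-∷ʳ (flip R?) (reverse xs) x ⟩
  backArcs (flip R?) (reverse xs) + deg (flip R?) x (reverse xs)
    ≡⟨ cong₂ _+_ (backArcs-reverse R? xs) (deg-↭ (flip R?) x (↭-reverse xs)) ⟩
  backArcs R? xs + deg (flip R?) x xs
    ≡⟨ +-comm (backArcs R? xs) _ ⟩
  deg (flip R?) x xs + backArcs R? xs ∎
  where open ≡-Reasoning

Unique-resp-↭ : ∀ {A : Set} {xs ys : List A} → xs ↭ ys → Unique xs → Unique ys
Unique-resp-↭ = Permutationₛ.Unique-resp-↭ (setoid _) ∘ ↭⇒↭ₛ

Semicomplete : ∀ {A : Set} → Rel A 0ℓ → Set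
Semicomplete R = ∀ u v → u ≢ v → R u v ⊎ R v u

module _ {A : Set} {R : Rel A 0ℓ} (R? : Decidable R) (total : Semicomplete R) where

  length≤out+in : ∀ {x} ys → All (x ≢_) ys → length ys ≤ deg R? x ys + deg (flip R?) x ys
  length≤out+in     []       []           = z≤n
  length≤out+in {x} (y ∷ ys) (x≢y ∷ x∉ys) with R? x y | R? y x | length≤out+in ys x∉ys
  ... | yes _ | yes _ | ih = s≤s (≤-trans ih (+-monoʳ-≤ (deg R? x ys) (n≤1+n _)))
  ... | yes _ | no _  | ih = s≤s ih
  ... | no _  | yes _ | ih = ≤-trans (s≤s ih) (≤-reflexive (sym (+-suc (deg R? x ys) _)))
  ... | no ¬p | no ¬q | _  with total x y x≢y
  ...   | inj₁ p = contradiction p ¬p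
  ...   | inj₂ q = contradiction q ¬q

  -- A vertex beaten by more than half of the block behind it is moved behind that block.
  feedback⊎improve : ∀ {xs} → Unique xs →
    Feedback R? xs ⊎ ∃[ ys ] ys ↭ xs × backArcs R? ys < backArcs R? xs
  feedback⊎improve []                       = inj₁ []
  feedback⊎improve {x ∷ xs} (x∉ ∷ xs!) with feedback⊎improve xs!
  ... | inj₂ (ys , ys↭xs , ys<xs) = inj₂ (x ∷ ys , prep x ys↭xs ,
          +-mono-≤-< (≤-reflexive (deg-↭ (flip R?) x ys↭xs)) ys<xs)
  ... | inj₁ fb with anyUpTo? (λ ℓ → 2 * deg R? x (take ℓ xs) <? ℓ) (suc (length xs))
  ...   | no ¬viol = inj₁ ((λ {ℓ} ℓ≤ → ≮⇒≥ (λ viol → ¬viol (ℓ , s≤s ℓ≤ , viol))) ∷ fb)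
  ...   | yes (ℓ , s≤s ℓ≤ , viol) = inj₂ (I ++ x ∷ J , perm , decreases)
    where
    I = take ℓ xs
    J = drop ℓ xs
    I++J : I ++ J ≡ xs
    I++J = take++drop≡id ℓ xs
    perm : I ++ x ∷ J ↭ x ∷ xs
    perm = subst (λ zs → I ++ x ∷ J ↭ x ∷ zs) I++J (shift x I J)
    -- Fewer than half of the vertices of `I` are dominated by `x`, and all the others dominate `x`.
    out<in : deg R? x I < deg (flip R?) x I
    out<in = +-cancelˡ-< (deg R? x I) _ _ (begin-strict
      deg R? x I + deg R? x I         ≡⟨ cong (deg R? x I +_) (+-identityʳ _) ⟨
      2 * deg R? x I                  <⟨ viol ⟩
      ℓ                               ≡⟨ m≤n⇒m⊓n≡m ℓ≤ ⟨
      ℓ ⊓ length xs                   ≡⟨ length-take ℓ xs ⟨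
      length I                        ≤⟨ length≤out+in I (All.take⁺ ℓ x∉) ⟩
      deg R? x I + deg (flip R?) x I  ∎)
      where open ≤-Reasoning
    decreases : backArcs R? (I ++ x ∷ J) < backArcs R? (x ∷ xs)
    decreases = +-cancelʳ-< (deg R? x I) _ _ (begin-strict
      backArcs R? (I ++ x ∷ J) + deg R? x I         <⟨ +-monoʳ-< (backArcs R? (I ++ x ∷ J)) out<in ⟩
      backArcs R? (I ++ x ∷ J) + deg (flip R?) x I  ≡⟨ backArcs-move R? x I J ⟨
      backArcs R? (x ∷ I ++ J) + deg R? x I         ≡⟨ cong (λ zs → backArcs R? (x ∷ zs) + deg R? x I) I++J ⟩
      backArcs R? (x ∷ xs) + deg R? x I             ∎)
      where open ≤-Reasoning

module _ {A : Set} {R : Rel A 0ℓ} (R? : Decidable R) (total : Semicomplete R) where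

  LocalMedianOrder : List A → Set
  LocalMedianOrder xs = Feedback R? xs × Feedback (flip R?) (reverse xs)

  -- Whichever of the two feedback conditions fails, the same measure decreases: the number of
  -- backward arcs of the list.
  localMedianOrder : ∀ {xs} → Unique xs → ∃[ ys ] ys ↭ xs × LocalMedianOrder ys
  localMedianOrder xs! = descend _ xs! (<-wellFounded _)
    where
    descend : ∀ xs → Unique xs → Acc _<_ (backArcs R? xs) → ∃[ ys ] ys ↭ xs × LocalMedianOrder ys
    descend xs xs! (acc rec) with feedback⊎improve R? total xs!
                                | feedback⊎improve (flip R?) (λ u v → swap ∘ total u v)
                                    (Unique-resp-↭ (↭-sym (↭-reverse xs)) xs!)
    ... | inj₂ (ys , ys↭xs , ys<xs) | _ =
      let zs , zs↭ys , med = descend ys (Unique-resp-↭ (↭-sym ys↭xs) xs!) (rec ys<xs)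
      in zs , ↭-trans zs↭ys ys↭xs , med
    ... | inj₁ _  | inj₂ (ys , ys↭rev , ys<rev) =
      let ysʳ↭xs = ↭-trans (↭-reverse ys) (↭-trans ys↭rev (↭-reverse xs))
          ysʳ<xs = subst₂ _<_ (sym (backArcs-reverse (flip R?) ys)) (backArcs-reverse R? xs) ys<rev
          zs , zs↭ , med = descend (reverse ys) (Unique-resp-↭ (↭-sym ysʳ↭xs) xs!) (rec ysʳ<xs)
      in zs , ↭-trans zs↭ ysʳ↭xs , med
    ... | inj₁ fb | inj₁ fbʳ = xs , ↭-refl , fb , fbʳ

-- Embedding a tree leaf by leaf into an order with the feedback property.

data Grown {V : Set} (E : Rel V 0ℓ) (r : V) : List V → Set where
  root   : Grown E r []
  -- When attached, `x` is a leaf: the only possible arc between `x` and the earlier vertices comes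
  -- from its parent `y`.
  attach : ∀ {vs x y} → Grown E r vs → x ∉ r ∷ vs → y ∈ r ∷ vs →
           (∀ {u} → u ∈ r ∷ vs → E u x → u ≡ y) → (∀ {u} → u ∈ r ∷ vs → ¬ E x u) →
           Grown E r (x ∷ vs)

beyond : ∀ {V : Set} {N} → (V → Fin N) → ℕ → List V → ℕ
beyond place i vs = length (filter (λ v → i <? toℕ (place v)) vs)

module _ {V A : Set} (E : Rel V 0ℓ) (R : Rel A 0ℓ) where

  -- The condition sparse leaves, behind every position, room for a further child.
  record Embedding (r : V) (vs : List V) (x₀ : A) (xs : List A) : Set where
    field
      place     : V → Fin (suc (length xs))
      place-r   : place r ≡ zero
      injective : ∀ {u v} → u ∈ r ∷ vs → v ∈ r ∷ vs → place u ≡ place v → u ≡ v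
      preserves : ∀ {u v} → u ∈ r ∷ vs → v ∈ r ∷ vs → E u v →
                  R (lookup (x₀ ∷ xs) (place u)) (lookup (x₀ ∷ xs) (place v))
      sparse    : ∀ i → 2 * beyond place i vs ≤ 2 * length vs ∸ i

    -- A vertex at position `suc i` is one of those beyond `i`, so `sparse i` forces
    -- `2 * length vs ∸ i` to be positive.
    position≤ : ∀ {y} → y ∈ r ∷ vs → toℕ (place y) ≤ 2 * length vs
    position≤ (here refl) = subst (λ j → toℕ j ≤ _) (sym place-r) z≤n
    position≤ {y} (there y∈) with toℕ (place y) in eq
    ... | zero  = z≤n
    ... | suc i = m∸n≢0⇒n<m λ room≡0 → contradiction
          (≤-trans (*-monoʳ-≤ 2 (filter-some (λ v → i <? toℕ (place v)) (lose y∈ (≤-reflexive (sym eq)))))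
                   (≤-trans (sparse i) (≤-reflexive room≡0)))
          λ ()

module _ {V A : Set} (_≟ⱽ_ : DecidableEquality V) (_≟ᴬ_ : DecidableEquality A)
         {E : Rel V 0ℓ} (E-irrefl : ∀ {u} → ¬ E u u) {R : Rel A 0ℓ} (R? : Decidable R) where

  module _ {x₀ : A} {xs : List A} (W! : Unique (x₀ ∷ xs)) (fb : Feedback R? (x₀ ∷ xs)) where

    private
      W = x₀ ∷ xs

    module Attach {r vs x y} (em : Embedding E R r vs x₀ xs) (x∉ : x ∉ r ∷ vs) (y∈ : y ∈ r ∷ vs)
                  (only-y : ∀ {u} → u ∈ r ∷ vs → E u x → u ≡ y)
                  (source : ∀ {u} → u ∈ r ∷ vs → ¬ E x u)
                  (enough : 2 * suc (length vs) ≤ suc (length xs)) where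
      open Embedding em

      k = length vs
      i = toℕ (place y)
      -- The block consists of the positions from `suc i` to `suc (2 * k)`, the last of the
      -- `2 * suc k` positions that may be used. By `position≤` the subtraction is not truncated.
      ℓ = suc (2 * k) ∸ i
      block = take ℓ (drop (suc i) W)

      ℓ+i : suc i + ℓ ≡ 2 * suc k
      ℓ+i = begin
        suc (i + (suc (2 * k) ∸ i))  ≡⟨ cong suc (m+[n∸m]≡n (m≤n⇒m≤1+n (position≤ y∈))) ⟩
        suc (suc (2 * k))            ≡⟨ *-suc 2 k ⟨
        2 * suc k                    ∎
        where open ≡-Reasoning

      ℓ≤ : ℓ ≤ length (drop (suc i) W)
      ℓ≤ = begin
        ℓ                          ≡⟨ m+n∸m≡n (suc i) ℓ ⟨
        suc i + ℓ ∸ suc i          ≡⟨ cong (_∸ suc i) ℓ+i ⟩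
        2 * suc k ∸ suc i          ≤⟨ ∸-monoˡ-≤ (suc i) enough ⟩
        length W ∸ suc i           ≡⟨ length-drop (suc i) W ⟨
        length (drop (suc i) W)    ∎
        where open ≤-Reasoning

      used : List A
      used = map (lookup W ∘ place) (filter (λ v → i <? toℕ (place v)) vs)

      -- `ℓ` exceeds by one the bound given by `sparse i`, which makes the inequality strict
      -- whatever the parity.
      used<out : length used < deg R? (lookup W (place y)) block
      used<out = *-cancelˡ-< 2 _ _ (begin-strict
        2 * length used                          ≡⟨ cong (2 *_) (length-map _ (filter _ vs)) ⟩
        2 * beyond place i vs                    ≤⟨ sparse i ⟩
        2 * k ∸ i                                <⟨ ∸-monoˡ-< ≤-refl (position≤ y∈) ⟩
        ℓ                                        ≤⟨ feedback-lookup R? fb (place y) ℓ≤ ⟩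
        2 * deg R? (lookup W (place y)) block    ∎)
        where open ≤-Reasoning

      free : ∃[ j ] R (lookup W (place y)) (lookup W j) × i < toℕ j × toℕ j < 2 * suc k ×
                    (∀ {v} → v ∈ r ∷ vs → place v ≢ j)
      free with pigeonhole _≟ᴬ_ (Unique.filter⁺ (R? (lookup W (place y)))
                                  (Unique.take⁺ ℓ (Unique.drop⁺ (suc i) W!))) used<out
      ... | z , z∈ , z∉used with ∈-filter⁻ (R? (lookup W (place y))) {xs = block} z∈
      ... | z∈block , Ryz with ∈-take-drop⁻ (suc i) ℓ W z∈block
      ... | j , refl , i<j , j< = j , Ryz , i<j , subst (toℕ j <_) ℓ+i j< , unused
        where
        unused : ∀ {v} → v ∈ r ∷ vs → place v ≢ j
        -- The root is at position zero, which is not behind `i`.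
        unused (here refl) refl = contradiction (subst (λ p → i < toℕ p) place-r i<j) λ ()
        unused (there v∈)  refl = z∉used (∈-map⁺ (lookup W ∘ place)
          (∈-filter⁺ (λ v → i <? toℕ (place v)) v∈ i<j))

      j = proj₁ free
      y→j = proj₁ (proj₂ free)
      j<2k+2 = proj₁ (proj₂ (proj₂ (proj₂ free)))
      unused = proj₂ (proj₂ (proj₂ (proj₂ free)))

      place′ : V → Fin (length W)
      place′ v with v ≟ⱽ x
      ... | yes _ = j
      ... | no  _ = place v

      place′-x : place′ x ≡ j
      place′-x with x ≟ⱽ x
      ... | yes _  = refl
      ... | no x≢x = contradiction refl x≢x

      place′-old : ∀ {v} → v ∈ r ∷ vs → place′ v ≡ place v
      place′-old {v} v∈ with v ≟ⱽ x
      ... | yes refl = contradiction v∈ x∉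
      ... | no  _    = refl

      injective′ : ∀ {u v} → u ∈ r ∷ x ∷ vs → v ∈ r ∷ x ∷ vs → place′ u ≡ place′ v → u ≡ v
      injective′ u∈ v∈ eq with ∈-insert₂⁻ u∈ | ∈-insert₂⁻ v∈
      ... | inj₁ refl | inj₁ refl = refl
      ... | inj₁ refl | inj₂ v∈′  =
        contradiction (trans (sym (place′-old v∈′)) (trans (sym eq) place′-x)) (unused v∈′)
      ... | inj₂ u∈′  | inj₁ refl =
        contradiction (trans (sym (place′-old u∈′)) (trans eq place′-x)) (unused u∈′)
      ... | inj₂ u∈′  | inj₂ v∈′  =
        injective u∈′ v∈′ (trans (sym (place′-old u∈′)) (trans eq (place′-old v∈′)))

      preserves′ : ∀ {u v} → u ∈ r ∷ x ∷ vs → v ∈ r ∷ x ∷ vs → E u v →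
                   R (lookup W (place′ u)) (lookup W (place′ v))
      preserves′ u∈ v∈ Euv with ∈-insert₂⁻ u∈ | ∈-insert₂⁻ v∈
      ... | inj₁ refl | inj₁ refl = contradiction Euv E-irrefl
      ... | inj₁ refl | inj₂ v∈′  = contradiction Euv (source v∈′)
      ... | inj₂ u∈′  | inj₁ refl with only-y u∈′ Euv
      ...   | refl = subst₂ (λ p q → R (lookup W p) (lookup W q))
                       (sym (place′-old y∈)) (sym place′-x) y→j
      preserves′ u∈ v∈ Euv | inj₂ u∈′ | inj₂ v∈′ =
        subst₂ (λ p q → R (lookup W p) (lookup W q))
          (sym (place′-old u∈′)) (sym (place′-old v∈′)) (preserves u∈′ v∈′ Euv)

      beyond-old : ∀ a → beyond place′ a vs ≤ beyond place a vs
      beyond-old a = length-filter-mono _ _ vs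
        (λ v∈ → subst (λ p → a < toℕ p) (place′-old (there v∈)))

      -- The new leaf counts only for `a` below its position, hence for `a ≤ 2 * k`; there the bound
      -- grows by the two that are needed. For other `a` the left side does not grow.
      sparse′ : ∀ a → 2 * beyond place′ a (x ∷ vs) ≤ 2 * length (x ∷ vs) ∸ a
      sparse′ a with a <? toℕ (place′ x)
      ... | no ¬a<j = begin
        2 * beyond place′ a (x ∷ vs)
          ≡⟨ cong ((2 *_) ∘ length) (filter-reject (λ v → a <? toℕ (place′ v)) {xs = vs} ¬a<j) ⟩
        2 * beyond place′ a vs         ≤⟨ *-monoʳ-≤ 2 (beyond-old a) ⟩
        2 * beyond place a vs          ≤⟨ sparse a ⟩
        2 * k ∸ a                      ≤⟨ ∸-monoˡ-≤ a (*-monoʳ-≤ 2 (n≤1+n k)) ⟩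
        2 * suc k ∸ a                  ∎
        where open ≤-Reasoning
      ... | yes a<j = begin
        2 * beyond place′ a (x ∷ vs)
          ≡⟨ cong ((2 *_) ∘ length) (filter-accept (λ v → a <? toℕ (place′ v)) {xs = vs} a<j) ⟩
        2 * suc (beyond place′ a vs)   ≡⟨ *-suc 2 _ ⟩
        2 + 2 * beyond place′ a vs     ≤⟨ +-monoʳ-≤ 2 (≤-trans (*-monoʳ-≤ 2 (beyond-old a)) (sparse a)) ⟩
        2 + (2 * k ∸ a)                ≡⟨ +-∸-assoc 2 a≤2k ⟨
        2 + 2 * k ∸ a                  ≡⟨ cong (_∸ a) (*-suc 2 k) ⟨
        2 * suc k ∸ a                  ∎
        where
        open ≤-Reasoning
        a≤2k : a ≤ 2 * k
        a≤2k = ≤-pred (≤-pred (subst (suc (suc a) ≤_) (*-suc 2 k)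
                 (≤-<-trans (subst (λ p → a < toℕ p) place′-x a<j) j<2k+2)))

      extended : Embedding E R r (x ∷ vs) x₀ xs
      extended = record
        { place     = place′
        ; place-r   = trans (place′-old (here refl)) place-r
        ; injective = injective′
        ; preserves = preserves′
        ; sparse    = sparse′
        }

    embed : ∀ {r vs} → Grown E r vs → 2 * length vs ≤ suc (length xs) → Embedding E R r vs x₀ xs
    embed root _ = record
      { place     = λ _ → zero
      ; place-r   = refl
      ; injective = λ { (here refl) (here refl) _ → refl }
      ; preserves = λ { (here refl) (here refl) Err → contradiction Err E-irrefl }
      ; sparse    = λ _ → z≤n
      }
    embed {vs = _ ∷ vs} (attach g x∉ y∈ only-y source) enough =
      Attach.extended (embed g (≤-trans (*-monoʳ-≤ 2 (n≤1+n (length vs))) enough)) x∉ y∈ only-y source enough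

-- Paths in trees and growing an arborescence from its root.

unique⇒length≤ : ∀ {n} {xs : List (Fin n)} → Unique xs → length xs ≤ n
unique⇒length≤ {n} {xs} xs! =
  subst (length xs ≤_) (length-tabulate {n = n} (λ i → i)) (unique⊆⇒length≤ xs! (λ _ → ∈-allFin _))

module _ {V : Set} {R : Rel V 0ℓ} where

  start∈ : ∀ {x y p} → Walk R x y p → x ∈ p
  start∈ [-]     = here refl
  start∈ (_ ∷ _) = here refl

  walk-++ : ∀ {x y z w p q} → Walk R x y p → R y z → Walk R z w q → Walk R x w (p ++ q)
  walk-++ [-]       Ryz ws′ = Ryz ∷ ws′
  walk-++ (Rx ∷ ws) Ryz ws′ = Rx ∷ walk-++ ws Ryz ws′

  walk-length≥1 : ∀ {x y p} → Walk R x y p → 1 ≤ length p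
  walk-length≥1 [-]     = s≤s z≤n
  walk-length≥1 (_ ∷ _) = s≤s z≤n

  walk-length≥2 : ∀ {x y p} → Walk R x y p → x ≢ y → 2 ≤ length p
  walk-length≥2 [-]      x≢x = contradiction refl x≢x
  walk-length≥2 (_ ∷ ws) _   = s≤s (walk-length≥1 ws)

  LastExit : U.Pred V 0ℓ → V → List V → Set
  LastExit P b p = ∃[ w ] ∃[ z ] ∃[ q ]
    P w × w ∈ p × R w z × Walk R z b q × Unique q × All (λ v → ¬ P v) q

  -- The tail of the walk is examined first, so the exit found is the last one. It supplies both the
  -- next edge of a growing tree and the cycle in `¬nearer-outside`.
  outside⊎lastExit : ∀ {P : U.Pred V 0ℓ} → U.Decidable P → ∀ {a b p} → Walk R a b p → Unique p →
                     ¬ P b → All (λ v → ¬ P v) p ⊎ LastExit P b p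
  outside⊎lastExit P? [-] _ ¬Pb = inj₁ (¬Pb ∷ [])
  outside⊎lastExit P? {a} (Rac ∷ ws) (_ ∷ p!) ¬Pb with outside⊎lastExit P? ws p! ¬Pb
  ... | inj₂ (w , z , q , Pw , w∈ , rest) = inj₂ (w , z , q , Pw , there w∈ , rest)
  ... | inj₁ out with P? a
  ...   | yes Pa = inj₂ (a , _ , _ , Pa , here refl , Rac , ws , p! , out)
  ...   | no ¬Pa = inj₁ (¬Pa ∷ out)

module _ {n : ℕ} {G : OrientedGraph n} (H : Subgraph G) where

  -- Connectedness of the subgraph of `H` induced by `P`.
  LinkedWithin : U.Pred (Fin n) 0ℓ → Set
  LinkedWithin P = ∀ {u w} → P u → P w → ∃[ p ] IsPath H u w p × All P p

  All⇒≢ : ∀ {P : U.Pred (Fin n) 0ℓ} {x p} → ¬ P x → All P p → All (x ≢_) p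
  All⇒≢ ¬Px = All.map (λ { Pv refl → ¬Px Pv })

  -- `Q` stands for `P` with `x` added; it is described by implications because the grown list
  -- inserts `x` behind the root and not in front.
  link-vertex : ∀ {P Q : U.Pred (Fin n) 0ℓ} {x y} → LinkedWithin P → (∀ {v} → P v → Q v) →
                (∀ {v} → Q v → v ≡ x ⊎ P v) → Q x → P y → ¬ P x → Adjacent H y x → LinkedWithin Q
  link-vertex linked P⇒Q Q⇒ Qx Py ¬Px y~x Qu Qw with Q⇒ Qu | Q⇒ Qw
  ... | inj₁ refl | inj₁ refl = _ , ([-] , [] ∷ []) , Qx ∷ []
  ... | inj₂ Pu   | inj₂ Pw   = let p , path , Pp = linked Pu Pw in p , path , All.map P⇒Q Pp
  ... | inj₁ refl | inj₂ Pw   =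
    let p , (ws , p!) , Pp = linked Py Pw
    in _ , (symmetric _ y~x ∷ ws , All⇒≢ ¬Px Pp ∷ p!) , Qx ∷ All.map P⇒Q Pp
  ... | inj₂ Pu   | inj₁ refl =
    let p , (ws , p!) , Pp = linked Pu Py
    in _ , (walk-++ ws y~x [-] ,
            Unique.++⁺ p! ([] ∷ []) λ { (v∈ , here refl) → ¬Px (All.lookup Pp v∈) }) ,
       All.++⁺ (All.map P⇒Q Pp) (Qx ∷ [])

  module _ (acyclic : Acyclic H) {P : U.Pred (Fin n) 0ℓ} (linked : LinkedWithin P) where

    -- A path within `P` between two distinct neighbours of `x` would be closed to a cycle by `x`.
    neighbour-unique : ∀ {x y u} → ¬ P x → P y → P u → Adjacent H y x → Adjacent H u x → u ≡ y
    neighbour-unique {u = u} ¬Px Py Pu y~x u~x with u Fin.≟ _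
    ... | yes u≡y = u≡y
    ... | no  u≢y =
      let p , (ws , p!) , Pp = linked Py Pu
      in contradiction u~x (acyclic (symmetric _ y~x ∷ ws , All⇒≢ ¬Px Pp ∷ p!)
                                    (s≤s (walk-length≥2 ws (≢-sym u≢y))))

    -- The last exit of the walk from P followed by the edge xy would close a cycle through P.
    ¬nearer-outside : U.Decidable P → ∀ {r x y} → P r → P y → ¬ P x → Adjacent H x y → ¬ Nearer H r x y
    ¬nearer-outside P? Pr Py ¬Px x~y (p , (ws , p!) , y∉p) with outside⊎lastExit P? ws p! ¬Px
    ... | inj₁ out = All.lookup out (start∈ ws) Pr
    ... | inj₂ (w , z , q , Pw , w∈p , w~z , ws′ , q! , out) =
      let p′ , (ws″ , p′!) , Pp′ = linked Py Pw
      in acyclic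
           (walk-++ ws″ w~z ws′ ,
            Unique.++⁺ p′! q! λ { (v∈p′ , v∈q) → All.lookup out v∈q (All.lookup Pp′ v∈p′) })
           (subst (3 ≤_) (sym (length-++ p′))
             -- `w` lies on the path that avoids `y`, so `p′` joins distinct vertices and the cycle
             -- has at least three vertices.
             (+-mono-≤ (walk-length≥2 ws″ (λ { refl → y∉p w∈p })) (walk-length≥1 ws′)))
           x~y

  module _ {r : Fin n} (tree : IsRootedTree H r) {E : Rel (Fin n) 0ℓ}
           (E⇒adjacent : ∀ {u v} → E u v → Adjacent H u v)
           (E⇒nearer : ∀ {u v} → E u v → Nearer H r u v) where
    open Subgraph H
    open IsRootedTree tree

    record Spanning (vs : List (Fin n)) : Set where
      field
        grown    : Grown E r vs
        unique   : Unique (r ∷ vs)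
        sound    : ∀ {v} → v ∈ r ∷ vs → v ∈ₛ vertices
        complete : ∀ {v} → v ∈ₛ vertices → v ∈ r ∷ vs

    -- As long as a vertex is missing, the path to it from the root leaves the grown part and yields
    -- a new leaf. Taking for `E` the arcs of an out-arborescence or the reversed arcs of an
    -- in-arborescence treats both kinds at once.
    spanning : ∃ Spanning
    spanning = grow n (m≤m+n n 0) root ([] ∷ [])
                 (λ { (here refl) → root∈ })
                 (λ { (here refl) (here refl) → _ , ([-] , [] ∷ []) , here refl ∷ [] })
      where
      infix 4 _∈?_
      _∈?_ : ∀ v vs → Dec (v ∈ vs)
      v ∈? vs = any? (v Fin.≟_) vs

      head∈vertices : ∀ {y x} → Adjacent H y x → x ∈ₛ vertices
      head∈vertices (fwd a) = head∈ a
      head∈vertices (bwd a) = tail∈ a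

      grow : ∀ fuel {vs} → n ≤ fuel + length vs → Grown E r vs → Unique (r ∷ vs) →
             (∀ {v} → v ∈ r ∷ vs → v ∈ₛ vertices) → LinkedWithin (_∈ r ∷ vs) → ∃ Spanning
      -- Without fuel, `r ∷ vs` would consist of more than `n` distinct vertices.
      grow zero n≤ _ r∷vs! _ _ = contradiction (unique⇒length≤ r∷vs!) (<⇒≱ (s≤s n≤))
      grow (suc fuel) {vs} n≤ grown r∷vs! sound linked
        with Fin.any? (λ v → (v ∈ₛ? vertices) ×-dec ¬? (v ∈? r ∷ vs))
      ... | no ¬missing = vs , record
            { grown = grown ; unique = r∷vs! ; sound = sound ; complete = complete }
        where
        complete : ∀ {v} → v ∈ₛ vertices → v ∈ r ∷ vs
        complete {v} v∈ with v ∈? r ∷ vs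
        ... | yes v∈vs = v∈vs
        ... | no  v∉vs = contradiction (v , v∈ , v∉vs) ¬missing
      ... | yes (v , v∈ , v∉) with connected root∈ v∈
      ... | p , (ws , p!) with outside⊎lastExit (_∈? r ∷ vs) ws p! v∉
      ... | inj₁ out = contradiction (here refl) (All.lookup out (start∈ ws))
      -- The new leaf is the first vertex `x` after the last exit, which may differ from the missing
      -- vertex `v`.
      ... | inj₂ (y , x , q , y∈ , _ , y~x , ws′ , _ , out) =
            grow fuel (subst (n ≤_) (sym (+-suc fuel (length vs))) n≤)
              (attach grown x∉ y∈
                (λ u∈ Eux → neighbour-unique acyclic linked x∉ y∈ u∈ y~x (E⇒adjacent Eux))
                -- An `E`-arc from `x` to `u` would put `x`, outside the grown part, nearer to the
                -- root than `u` inside it.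
                (λ u∈ Exu → ¬nearer-outside acyclic linked (_∈? r ∷ vs) (here refl) u∈ x∉
                              (E⇒adjacent Exu) (E⇒nearer Exu)))
              (insert! r∷vs!)
              (sound′ ∘ ∈-insert₂⁻)
              (link-vertex linked ∈-insert₂⁺ ∈-insert₂⁻ (there (here refl)) y∈ x∉ y~x)
        where
        x∉ : x ∉ r ∷ vs
        x∉ = All.lookup out (start∈ ws′)

        insert! : Unique (r ∷ vs) → Unique (r ∷ x ∷ vs)
        insert! (r∉ ∷ vs!) =
          ((λ { refl → x∉ (here refl) }) ∷ r∉) ∷ All.¬Any⇒All¬ vs (x∉ ∘ there) ∷ vs!

        sound′ : ∀ {u} → u ≡ x ⊎ u ∈ r ∷ vs → u ∈ₛ vertices
        sound′ (inj₁ refl) = head∈vertices y~x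
        sound′ (inj₂ u∈)   = sound u∈

-- Splitting the order at the image of the root and gluing the two embeddings.

unique-++⁻ : ∀ {A : Set} (xs : List A) {ys} → Unique (xs ++ ys) →
             Unique ys × (∀ {v} → v ∈ xs → v ∉ ys)
unique-++⁻ []       ys!        = ys! , λ ()
unique-++⁻ (x ∷ xs) (x∉ ∷ zs!) =
  let ys! , disjoint = unique-++⁻ xs zs!
  in ys! , λ { (here refl) v∈ys → All.lookup x∉ (∈-++⁺ʳ xs v∈ys) refl
             ; (there v∈xs) → disjoint v∈xs }

reverse-around : ∀ {A : Set} (xs : List A) {x ys} → reverse (xs ++ x ∷ ys) ≡ reverse ys ++ x ∷ reverse xs
reverse-around xs {x} {ys} = begin
  reverse (xs ++ x ∷ ys)                ≡⟨ reverse-++ xs (x ∷ ys) ⟩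
  reverse (x ∷ ys) ++ reverse xs        ≡⟨ cong (_++ reverse xs) (unfold-reverse x ys) ⟩
  (reverse ys ++ [ x ]) ++ reverse xs   ≡⟨ ++-assoc (reverse ys) [ x ] (reverse xs) ⟩
  reverse ys ++ x ∷ reverse xs          ∎
  where open ≡-Reasoning

-- The list `x ∷ reverse xs` is a suffix of the reversed list.
unique-reverse-prefix : ∀ {A : Set} (xs : List A) {x ys} → Unique (xs ++ x ∷ ys) → Unique (x ∷ reverse xs)
unique-reverse-prefix xs {ys = ys} zs! = proj₁ (unique-++⁻ (reverse ys)
  (subst Unique (reverse-around xs) (Unique-resp-↭ (↭-sym (↭-reverse _)) zs!)))

split-at : ∀ {A : Set} (xs : List A) {p} → p < length xs →
           ∃[ ys ] ∃[ x ] ∃[ zs ] xs ≡ ys ++ x ∷ zs × length ys ≡ p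
split-at (x ∷ xs) {zero}  _         = [] , x , xs , refl , refl
split-at (x ∷ xs) {suc p} (s≤s p<n) with split-at xs p<n
... | ys , y , zs , refl , refl = x ∷ ys , y , zs , refl , refl

module Glue {n m : ℕ} (D : OrientedGraph n) {r : Fin n} (bi : IsBiArborescenceAt D r)
            (T : OrientedGraph m) where
  open OrientedGraph D using (_⟶_; asym)
  open OrientedGraph T using () renaming (_⟶_ to _⟶ᵀ_)
  open IsBiArborescenceAt bi
  open IsInArborescence isInArborescence using (towards) renaming (isRootedTree to inTree)
  open IsOutArborescence isOutArborescence using (away) renaming (isRootedTree to outTree)

  ⟶-irrefl : ∀ {u} → ¬ u ⟶ u
  ⟶-irrefl u⟶u = asym u⟶u u⟶u

  inSpanning : ∃ (Spanning inPart inTree {E = flip I.arc} bwd towards)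
  inSpanning = spanning inPart inTree bwd towards

  outSpanning : ∃ (Spanning outPart outTree {E = O.arc} fwd away)
  outSpanning = spanning outPart outTree fwd away

  ins outs : List (Fin n)
  ins  = proj₁ inSpanning
  outs = proj₁ outSpanning

  open Spanning (proj₂ inSpanning)
    renaming (grown to ins-grown; unique to ins!; sound to ins-sound; complete to ins-complete) public
  open Spanning (proj₂ outSpanning)
    renaming (grown to outs-grown; unique to outs!; sound to outs-sound; complete to outs-complete) public

  common⇒root : ∀ {v} → v ∈ₛ I.vertices → v ∈ₛ O.vertices → v ≡ r
  common⇒root v∈I v∈O = Subset.x∈⁅y⁆⇒x≡y r (subst (_ ∈ₛ_) meet (Subset.x∈p∩q⁺ (v∈I , v∈O)))

  -- The two parts share only the root, which is in neither `ins` nor `outs`; it accounts for the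
  -- strictness.
  ins+outs<n : length ins + length outs < n
  ins+outs<n = subst (_≤ n) (trans (length-++ ins) (+-suc (length ins) (length outs)))
    (unique⇒length≤ (Unique.++⁺ (Unique.drop⁺ 1 ins!) outs! disjoint))
    where
    disjoint : ∀ {v} → ¬ (v ∈ ins × v ∈ r ∷ outs)
    disjoint (v∈ins , v∈outs) with common⇒root (ins-sound (there v∈ins)) (outs-sound v∈outs)
    ... | refl = Unique.Unique[x∷xs]⇒x∉xs ins! v∈ins

  module _ {A B : List (Fin m)} {x₀ : Fin m} (L! : Unique (A ++ x₀ ∷ B))
           (em-in  : Embedding (flip I.arc) (flip _⟶ᵀ_) r ins x₀ (reverse A))
           (em-out : Embedding O.arc _⟶ᵀ_ r outs x₀ B) where
    module EI = Embedding em-in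
    module EO = Embedding em-out

    -- The root lies in both parts, and both maps send it to `x₀`.
    f-in f-out f : Fin n → Fin m
    f-in  v = lookup (x₀ ∷ reverse A) (EI.place v)
    f-out v = lookup (x₀ ∷ B) (EO.place v)
    f v with v ∈ₛ? O.vertices
    ... | yes _ = f-out v
    ... | no  _ = f-in v

    out-unique : Unique (x₀ ∷ B)
    out-unique = proj₁ (unique-++⁻ A L!)

    in-unique : Unique (x₀ ∷ reverse A)
    in-unique = unique-reverse-prefix A L!

    -- Only the root is placed at position zero; every later position belongs to `reverse A`.
    f-in≢r∈A : ∀ {v} → v ∈ r ∷ ins → v ≢ r → f-in v ∈ A
    f-in≢r∈A {v} v∈ v≢r with EI.place v in eq
    ... | zero  = contradiction (EI.injective v∈ (here refl) (trans eq (sym EI.place-r))) v≢r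
    ... | suc j = ∈-resp-↭ (↭-reverse A) (∈-lookup j)

    f-in-out-disjoint : ∀ {u v} → u ∈ r ∷ ins → u ≢ r → f-in u ≢ f-out v
    f-in-out-disjoint {v = v} u∈ u≢r eq = proj₂ (unique-++⁻ A L!) (f-in≢r∈A u∈ u≢r)
      (subst (_∈ x₀ ∷ B) (sym eq) (∈-lookup (EO.place v)))

    f-on-out : ∀ {v} → v ∈ₛ O.vertices → f v ≡ f-out v
    f-on-out {v} v∈O with v ∈ₛ? O.vertices
    ... | yes _  = refl
    ... | no v∉O = contradiction v∈O v∉O

    f-on-in : ∀ {v} → v ∈ₛ I.vertices → f v ≡ f-in v
    f-on-in {v} v∈I with v ∈ₛ? O.vertices
    ... | no _ = refl
    ... | yes v∈O with common⇒root v∈I v∈O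
    ...   | refl = trans (cong (lookup (x₀ ∷ B)) EO.place-r)
                         (sym (cong (lookup (x₀ ∷ reverse A)) EI.place-r))

    outside-O : ∀ {v} → v ∉ₛ O.vertices → v ∈ r ∷ ins × v ≢ r
    outside-O {v} v∉O with Subset.x∈p∪q⁻ I.vertices O.vertices (subst (v ∈ₛ_) (sym vertices-union) Subset.∈⊤)
    ... | inj₁ v∈I = ins-complete v∈I , λ { refl → v∉O (outs-sound (here refl)) }
    ... | inj₂ v∈O = contradiction v∈O v∉O

    f-injective : ∀ {u v} → f u ≡ f v → u ≡ v
    f-injective {u} {v} eq with u ∈ₛ? O.vertices | v ∈ₛ? O.vertices
    ... | yes u∈ | yes v∈ =
          EO.injective (outs-complete u∈) (outs-complete v∈) (lookup-injective out-unique eq)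
    ... | no  u∉ | no  v∉ =
          EI.injective (proj₁ (outside-O u∉)) (proj₁ (outside-O v∉)) (lookup-injective in-unique eq)
    ... | no  u∉ | yes _  =
          contradiction eq (f-in-out-disjoint (proj₁ (outside-O u∉)) (proj₂ (outside-O u∉)))
    ... | yes _  | no  v∉ =
          contradiction (sym eq) (f-in-out-disjoint (proj₁ (outside-O v∉)) (proj₂ (outside-O v∉)))

    f-preserves : ∀ {u v} → u ⟶ v → f u ⟶ᵀ f v
    f-preserves u⟶v with arcs-union u⟶v
    -- The in-part was embedded with its arcs and those of the tournament both reversed; the
    -- reversals cancel once head and tail are exchanged.
    ... | inj₁ arc = subst₂ _⟶ᵀ_ (sym (f-on-in (I.tail∈ arc))) (sym (f-on-in (I.head∈ arc)))
          (EI.preserves (ins-complete (I.head∈ arc)) (ins-complete (I.tail∈ arc)) arc)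
    ... | inj₂ arc = subst₂ _⟶ᵀ_ (sym (f-on-out (O.tail∈ arc))) (sym (f-on-out (O.head∈ arc)))
          (EO.preserves (outs-complete (O.tail∈ arc)) (outs-complete (O.head∈ arc)) arc)

    glued : T Contains D
    glued = f , f-injective , f-preserves

-- Choosing the position of the root and checking the room on both sides.

lemma3 : (n : ℕ) → 2 ≤ n → (D : OrientedGraph n) → IsBiArborescence D → Unavoidable (2 * n ∸ 2) D
lemma3 n 2≤n D (r , bi) T T-total = embedding
  where
  open Glue D bi T
  open IsBiArborescenceAt bi using (module I; module O)
  open OrientedGraph T using (_⟶?_)

  m p a b : ℕ
  m = 2 * n ∸ 2
  a = length ins
  b = length outs
  -- Together with `x₀` itself, the `p` vertices before it give the in-part `2 * a` positions, or
  -- one if `a` is zero.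
  p = 2 * a ∸ 1

  2a+2b≤m : 2 * a + 2 * b ≤ m
  2a+2b≤m = begin
    2 * a + 2 * b          ≡⟨ *-distribˡ-+ 2 a b ⟨
    2 * (a + b)            ≡⟨ m+n∸m≡n 2 _ ⟨
    2 + 2 * (a + b) ∸ 2    ≡⟨ cong (_∸ 2) (*-suc 2 (a + b)) ⟨
    2 * suc (a + b) ∸ 2    ≤⟨ ∸-monoˡ-≤ 2 (*-monoʳ-≤ 2 ins+outs<n) ⟩
    m                      ∎
    where open ≤-Reasoning

  pred< : ∀ {k l} → k ≤ l → 1 ≤ l → k ∸ 1 < l
  pred< {zero}  _   1≤l = 1≤l
  pred< {suc k} k<l _   = k<l

  -- If `a` is zero, `p` is zero as well, and `2 ≤ n` ensures that this position exists.
  p<m : p < m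
  p<m = pred< (m+n≤o⇒m≤o (2 * a) 2a+2b≤m) (≤-trans (s≤s z≤n) (∸-monoˡ-≤ 2 (*-monoʳ-≤ 2 2≤n)))

  |L|≡m : ∀ {L} → L ↭ allFin m → length L ≡ m
  |L|≡m L↭ = trans (↭-length L↭) (length-tabulate {n = m} (λ i → i))

  embedding : T Contains D
  embedding with localMedianOrder _⟶?_ T-total (Unique.allFin⁺ m)
  ... | L , L↭ , fb , fbʳ with split-at L (subst (p <_) (sym (|L|≡m L↭)) p<m)
  ... | A , x₀ , B , refl , |A|≡p = glued L!
      (embed Fin._≟_ Fin._≟_ (⟶-irrefl ∘ I.arc⇒⟶) (flip _⟶?_) (unique-reverse-prefix A L!)
        fb-in ins-grown in-room)
      (embed Fin._≟_ Fin._≟_ (⟶-irrefl ∘ O.arc⇒⟶) _⟶?_ (proj₁ (unique-++⁻ A L!))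
        (feedback-++⁻ʳ _⟶?_ A fb) outs-grown out-room)
    where
    L! = Unique-resp-↭ (↭-sym L↭) (Unique.allFin⁺ m)
    -- The feedback property passes to suffixes, and the suffix of the reversed order starting at
    -- `x₀` is `x₀ ∷ reverse A`.
    fb-in = feedback-++⁻ʳ (flip _⟶?_) (reverse B) (subst (Feedback (flip _⟶?_)) (reverse-around A) fbʳ)

    in-room : 2 * a ≤ suc (length (reverse A))
    in-room = subst (λ l → 2 * a ≤ suc l) (sym (trans (length-reverse A) |A|≡p)) (m≤n+m∸n (2 * a) 1)

    out-room : 2 * b ≤ suc (length B)
    out-room = +-cancelˡ-≤ p _ _ (begin
      p + 2 * b                   ≤⟨ +-monoˡ-≤ (2 * b) (m∸n≤m (2 * a) 1) ⟩
      2 * a + 2 * b               ≤⟨ 2a+2b≤m ⟩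
      m                           ≡⟨ |L|≡m L↭ ⟨
      length (A ++ x₀ ∷ B)        ≡⟨ length-++ A ⟩
      length A + suc (length B)   ≡⟨ cong (_+ suc (length B)) |A|≡p ⟩
      p + suc (length B)          ∎)
      where open ≤-Reasoning
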